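{- For every request sequence $\sigma$, every time $t$ and every $r\ge 1$, in the tree maintained by $\textsc{Random-Push}$ the expected depth at time $t$ of the item of rank $r$ is less than $\log_2 r + 3$ (and hence less than $\lfloor\log_2 r\rfloor+4$).
   Context: Self-adjusting complete tree model: a set $V$ of $n$ items is stored in a complete binary tree of $n$ servers, one item per server; the root has depth $0$ and an item's depth is that of its hosting server. A request sequence $\sigma=(\sigma^{(1)},\sigma^{(2)},\dots)$ is fixed in advance (oblivious adversary). The rank of an item $v$ at time $t$ is the number of distinct items requested since the last request of $v$ before $t$, including $v$. Algorithm $\textsc{Random-Push}$: upon a request to item $u$ hosted at server $s$ of depth $k$, it moves $u$ to the root and pushes the previous root item down along a random path starting at the root, where at each step one of the two children of the current server is chosen uniformly at random, for $k$ steps: each item on this path down to depth $k-1$ moves down one level to the next server on the path; the item $w$ previously hosted at the end of the path (at depth $k$) is moved to server $s$. -}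

module Defs where

open import Data.Nat using (ℕ; zero; suc; _+_; _*_; _∸_; _^_; _<_; _<?_)
open import Data.Bool using (Bool; true; false; _∧_; if_then_else_)
import Data.Bool as Bool
open import Data.Fin using (Fin)
import Data.Fin as Fin
open import Data.List using (List; []; _∷_; length; take; map; upTo; deduplicate; concatMap)
open import Data.List.Properties using (≡-dec)
open import Data.Nat.ListAction using (sum)
open import Data.Vec using (Vec; toList)
import Data.Vec as Vec
open import Data.Product using (Σ; _×_)
open import Relation.Nullary using (¬_)
open import Relation.Nullary.Decidable using (⌊_⌋)
open import Relation.Binary.PropositionalEquality using (_≡_)

-- Servers of the complete (perfect) binary tree with h levels are addressed by
-- the root-to-server path: a list of bits (false = left child, true = right
-- child).  The depth of a server is the length of its address.
Address : Set
Address = List Bool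

_≟ₐ_ : (a b : Address) → Relation.Nullary.Dec (a ≡ b)
_≟ₐ_ = ≡-dec Bool._≟_

Config : ℕ → Set
Config n = Fin n → Address

-- One Random-Push step serving request u, using the random child choices bs
-- (only the first k = depth(u) bits are used).  The random path is
-- p_i = take i bs.  u goes to the root; the item at p_i (i < k) goes to
-- p_{i+1}; the item at p_k (if it is not u) goes to the old server of u.
step : ∀ {n h} → Fin n → Vec Bool h → Config n → Config n
step {n} {h} u bs pos x with x Fin.≟ u
... | Relation.Nullary.yes _ = []
... | Relation.Nullary.no _ =
  let a    = pos x
      k    = length (pos u)
      path = toList bs
  in if ⌊ length a <? k ⌋ ∧ ⌊ a ≟ₐ take (length a) path ⌋
     then take (suc (length a)) path
     else (if ⌊ a ≟ₐ take k path ⌋ then pos u else a)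

runFrom : ∀ {n h t} → (ℕ → Fin n) → ℕ → Vec (Vec Bool h) t → Config n → Config n
runFrom σ i Vec.[]         pos = pos
runFrom σ i (bs Vec.∷ bss) pos = runFrom σ (suc i) bss (step (σ i) bs pos)

run : ∀ {n h t} → (ℕ → Fin n) → Vec (Vec Bool h) t → Config n → Config n
run σ bss pos = runFrom σ 0 bss pos

vecsOver : ∀ {A : Set} → List A → (t : ℕ) → List (Vec A t)
vecsOver xs zero    = Vec.[] ∷ []
vecsOver xs (suc t) = concatMap (λ x → map (x Vec.∷_) (vecsOver xs t)) xs

bitVecs : (m : ℕ) → List (Vec Bool m)
bitVecs m = vecsOver (false ∷ true ∷ []) m

-- All random choices for t steps (each equally likely; 2 ^ (h * t) of them).
choices : (h t : ℕ) → List (Vec (Vec Bool h) t)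
choices h t = vecsOver (bitVecs h) t

-- Sum over all random outcomes of the depth of item v at time t.
-- The expected depth is totalDepth / 2 ^ (h * t).
totalDepth : ∀ {n} (h : ℕ) → (ℕ → Fin n) → Config n → (t : ℕ) → Fin n → ℕ
totalDepth h σ pos₀ t v = sum (map (λ bss → length (run σ bss pos₀ v)) (choices h t))

window : ∀ {n} → (ℕ → Fin n) → ℕ → ℕ → List (Fin n)
window σ τ t = map (λ i → σ (τ + i)) (upTo (t ∸ τ))

HasRank : ∀ {n} → (ℕ → Fin n) → ℕ → Fin n → ℕ → Set
HasRank σ t v r =
  Σ ℕ λ τ → (τ < t) × (σ τ ≡ v) × (∀ i → τ < i → i < t → ¬ (σ i ≡ v))
          × (r ≡ length (deduplicate Fin._≟_ (window σ τ t)))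

{-# OPTIONS --safe #-}
-- Put L = ⌊log₂ r⌋ + 2, so that 2r < 2ᴸ, and call (depth − L)⁺ the excess of an
-- item.  Let W be the set of items requested since the last request of v, and
-- let Ψ = 2ᴸ · excess(v) + 2 · Σ_{w ∈ W} excess(w).  When an item u of depth
-- k > L is served, an item of depth d with L ≤ d < k is pushed with probability
-- 2⁻ᵈ ≤ 2⁻ᴸ, and no other excess grows, so E Ψ grows by at most 1 + 2|W|/2ᴸ ≤ 2;
-- if moreover u ∈ W, then u itself loses excess k − L ≥ 1, so E Ψ does not grow.
-- If k ≤ L, no excess grows.  Hence only first requests of items, at most r of
-- them, raise E Ψ, and 2ᴸ · E excess(v) ≤ 2r < 2ᴸ, that is, E depth(v) < L + 1.
module Submission where

open import Defs
open import Data.Nat using (ℕ; zero; suc; _+_; _*_; _∸_; _^_; _<_; _≤_; _⊓_; _<?_; z≤n; s≤s; z<s; ⌊_/2⌋; NonZero)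
open import Data.Nat.Properties
open import Data.Nat.ListAction using (sum)
open import Data.Nat.ListAction.Properties using (sum-++)
open import Data.Nat.Logarithm using (⌊log₂_⌋; ⌊log₂⌋-mono-≤; ⌊log₂[2^n]⌋≡n)
open import Data.Nat.Logarithm.Core using (⌊log2⌋)
open import Data.Nat.Tactic.RingSolver using (solve-∀)
open import Data.Bool using (Bool; true; false)
open import Data.Fin using (Fin)
import Data.Fin as Fin
open import Data.List using (List; []; _∷_; _++_; length; map; take; drop; filter; deduplicate; concatMap)
open import Data.List.Properties using (map-++; map-∘; length-take; filter-notAll)
open import Data.List.Membership.Propositional using (_∈_)
open import Data.List.Membership.Propositional.Properties using (∈-map⁺; ∈-upTo⁺; ∈-filter⁺; ∈-deduplicate⁺)
open import Data.List.Relation.Unary.Any using (here; there)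
import Data.List.Relation.Unary.Any as Any
open import Data.Product using (Σ; _×_; _,_)
open import Data.Sum using (_⊎_; inj₁; inj₂)
open import Data.Vec using (Vec; toList)
import Data.Vec as Vec
open import Data.Vec.Properties using (length-toList)
open import Function using (_∘_)
open import Function.Definitions using (Injective)
open import Induction.WellFounded using (Acc; acc)
open import Relation.Nullary using (yes; no; contradiction; ¬?)
open import Relation.Binary.PropositionalEquality using (_≡_; refl; sym; trans; cong; cong₂; subst)
open ≤-Reasoning

private variable
  A B : Set

-- Finite sums over lists and over vectors of random choices.

∑ : List A → (A → ℕ) → ℕ
∑ xs f = sum (map f xs)

∑-mono : ∀ (xs : List A) {f g} → (∀ x → f x ≤ g x) → ∑ xs f ≤ ∑ xs g
∑-mono []       le = z≤n
∑-mono (x ∷ xs) le = +-mono-≤ (le x) (∑-mono xs le)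

∑-+ : ∀ (xs : List A) f g → ∑ xs (λ x → f x + g x) ≡ ∑ xs f + ∑ xs g
∑-+ []       f g = refl
∑-+ (x ∷ xs) f g rewrite ∑-+ xs f g = eq (f x) (g x) (∑ xs f) (∑ xs g)
  where
  eq : ∀ a b c d → a + b + (c + d) ≡ a + c + (b + d)
  eq = solve-∀

∑-*ˡ : ∀ (xs : List A) c f → ∑ xs (λ x → c * f x) ≡ c * ∑ xs f
∑-*ˡ []       c f = sym (*-zeroʳ c)
∑-*ˡ (x ∷ xs) c f rewrite ∑-*ˡ xs c f = sym (*-distribˡ-+ c (f x) (∑ xs f))

∑-const : ∀ (xs : List A) c → ∑ xs (λ _ → c) ≡ length xs * c
∑-const []       c = refl
∑-const (x ∷ xs) c = cong (c +_) (∑-const xs c)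

∑-zero : ∀ (xs : List A) → ∑ xs (λ _ → 0) ≡ 0
∑-zero xs = trans (∑-const xs 0) (*-zeroʳ (length xs))

∑-++ : ∀ (xs ys : List A) f → ∑ (xs ++ ys) f ≡ ∑ xs f + ∑ ys f
∑-++ xs ys f = trans (cong sum (map-++ f xs ys)) (sum-++ (map f xs) (map f ys))

∑-concatMap : ∀ (g : A → List B) xs f → ∑ (concatMap g xs) f ≡ ∑ xs (λ x → ∑ (g x) f)
∑-concatMap g []       f = refl
∑-concatMap g (x ∷ xs) f =
  trans (∑-++ (g x) (concatMap g xs) f) (cong (∑ (g x) f +_) (∑-concatMap g xs f))

∑-cong : ∀ (xs : List A) {f g} → (∀ x → f x ≡ g x) → ∑ xs f ≡ ∑ xs g
∑-cong []       eq = refl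
∑-cong (x ∷ xs) eq = cong₂ _+_ (eq x) (∑-cong xs eq)

-- Conditioning on the first random choice: the vectors are listed grouped by their head. This
-- drives the inductions over the bits of a path and over the steps of a run.
∑-vecsOver : ∀ (xs : List A) t (f : Vec A (suc t) → ℕ) →
  ∑ (vecsOver xs (suc t)) f ≡ ∑ xs (λ x → ∑ (vecsOver xs t) (λ v → f (x Vec.∷ v)))
∑-vecsOver xs t f =
  trans (∑-concatMap (λ x → map (x Vec.∷_) (vecsOver xs t)) xs f)
        (∑-cong xs (λ x → cong sum (sym (map-∘ {g = f} {f = x Vec.∷_} (vecsOver xs t)))))

∑-one : ∀ (xs : List A) → ∑ xs (λ _ → 1) ≡ length xs
∑-one xs = trans (∑-const xs 1) (*-identityʳ (length xs))

length-vecsOver : ∀ (xs : List A) t → length (vecsOver xs t) ≡ length xs ^ t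
length-vecsOver xs zero    = refl
length-vecsOver xs (suc t) = begin-equality
  length (vecsOver xs (suc t))                      ≡⟨ ∑-one (vecsOver xs (suc t)) ⟨
  ∑ (vecsOver xs (suc t)) (λ _ → 1)                 ≡⟨ ∑-vecsOver xs t _ ⟩
  ∑ xs (λ _ → ∑ (vecsOver xs t) (λ _ → 1))          ≡⟨ ∑-const xs _ ⟩
  length xs * ∑ (vecsOver xs t) (λ _ → 1)           ≡⟨ cong (length xs *_) (trans (∑-one (vecsOver xs t)) (length-vecsOver xs t)) ⟩
  length xs ^ suc t                                 ∎

length-bitVecs : ∀ h → length (bitVecs h) ≡ 2 ^ h
length-bitVecs = length-vecsOver _

length-choices : ∀ h t → length (choices h t) ≡ 2 ^ (h * t)
length-choices h t = trans (length-vecsOver (bitVecs h) t)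
  (trans (cong (_^ t) (length-bitVecs h)) (^-*-assoc 2 h t))

-- Servers on the random path.

-- A numerical indicator, so that summing it counts the paths through a server. It consumes one bit
-- of each argument at a time, which fits `∑-vecsOver`.
isPrefix : Address → Address → ℕ
isPrefix []      _       = 1
isPrefix (_ ∷ _) []      = 0
isPrefix (false ∷ a) (false ∷ p) = isPrefix a p
isPrefix (true ∷ a)  (true ∷ p)  = isPrefix a p
isPrefix (false ∷ a) (true ∷ p)  = 0
isPrefix (true ∷ a)  (false ∷ p) = 0

isPrefix-take : ∀ a p → a ≡ take (length a) p → isPrefix a p ≡ 1
isPrefix-take []      p  eq = refl
isPrefix-take (b ∷ a) [] ()
isPrefix-take (false ∷ a) (false ∷ p) eq = isPrefix-take a p (cong (drop 1) eq)
isPrefix-take (true ∷ a)  (true ∷ p)  eq = isPrefix-take a p (cong (drop 1) eq)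
isPrefix-take (false ∷ a) (true ∷ p)  ()
isPrefix-take (true ∷ a)  (false ∷ p) ()

isPrefix≤1 : ∀ a p → isPrefix a p ≤ 1
isPrefix≤1 []      _       = ≤-refl
isPrefix≤1 (_ ∷ _) []      = z≤n
isPrefix≤1 (false ∷ a) (false ∷ p) = isPrefix≤1 a p
isPrefix≤1 (true ∷ a)  (true ∷ p)  = isPrefix≤1 a p
isPrefix≤1 (false ∷ a) (true ∷ p)  = z≤n
isPrefix≤1 (true ∷ a)  (false ∷ p) = z≤n

-- In probabilities: server a is on the random path with probability at most 2⁻ᵈ,
-- d = length a (only at most, since a may be deeper than the path is long).
∑-isPrefix : ∀ h a → 2 ^ length a * ∑ (bitVecs h) (isPrefix a ∘ toList) ≤ 2 ^ h
∑-isPrefix h [] = ≤-reflexive (trans (*-identityˡ _) (trans (∑-one (bitVecs h)) (length-bitVecs h)))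
∑-isPrefix zero (b ∷ a) = ≤-trans (≤-reflexive (*-zeroʳ (2 ^ suc (length a)))) z≤n
∑-isPrefix (suc h) (b ∷ a) = begin
  2 * 2 ^ length a * ∑ (bitVecs (suc h)) (isPrefix (b ∷ a) ∘ toList)
    -- Only paths whose first bit is `b` contribute, which leaves the sum for `a` over paths with
    -- one bit fewer.
    ≡⟨ cong (2 * 2 ^ length a *_) (trans (∑-vecsOver _ h _) (one-side b)) ⟩
  2 * 2 ^ length a * ∑ (bitVecs h) (isPrefix a ∘ toList)
    ≡⟨ *-assoc 2 (2 ^ length a) _ ⟩
  2 * (2 ^ length a * ∑ (bitVecs h) (isPrefix a ∘ toList))
    ≤⟨ *-monoʳ-≤ 2 (∑-isPrefix h a) ⟩
  2 ^ suc h ∎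
  where
  S = ∑ (bitVecs h) (isPrefix a ∘ toList)
  one-side : ∀ b → ∑ (false ∷ true ∷ []) (λ c → ∑ (bitVecs h) (λ bs → isPrefix (b ∷ a) (c ∷ toList bs))) ≡ S
  one-side false rewrite ∑-zero (bitVecs h) = +-identityʳ S
  one-side true  rewrite ∑-zero (bitVecs h) = +-identityʳ S

-- Depth changes in a single step.

-- Each step draws `h` bits, so under this invariant the path is long enough to reach the depth of
-- any requested item.
Bounded : ∀ {n} → ℕ → Config n → Set
Bounded h pos = ∀ x → length (pos x) ≤ h

module _ {n h} (u : Fin n) (bs : Vec Bool h) (pos : Config n) (bounded : Bounded h pos) where

  length-take-path : ∀ m → length (take m (toList bs)) ≡ m ⊓ h
  length-take-path m = trans (length-take m (toList bs)) (cong (m ⊓_) (length-toList bs))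

  step-bounded : Bounded h (step u bs pos)
  step-bounded x with x Fin.≟ u
  ... | yes _ = z≤n
  ... | no _ with length (pos x) <? length (pos u) | pos x ≟ₐ take (length (pos x)) (toList bs)
                | pos x ≟ₐ take (length (pos u)) (toList bs)
  ... | yes _ | yes _ | _     = ≤-trans (≤-reflexive (length-take-path (suc (length (pos x))))) (m⊓n≤n _ h)
  ... | yes _ | no _  | yes _ = bounded u
  ... | yes _ | no _  | no _  = bounded x
  ... | no _  | _     | yes _ = bounded u
  ... | no _  | _     | no _  = bounded x

  step-requested : step u bs pos u ≡ []
  step-requested with u Fin.≟ u
  ... | yes _  = refl
  ... | no u≢u = contradiction refl u≢u

  -- The end of the path is at the depth of `u`, because `bounded u` keeps `take` from being cut
  -- short. Hence the item moved to the old server of `u` keeps its depth.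
  swap-length : ∀ {a} → a ≡ take (length (pos u)) (toList bs) → length (pos u) ≡ length a
  swap-length e = sym (trans (cong length e)
    (trans (length-take-path (length (pos u))) (m≤n⇒m⊓n≡m (bounded u))))

  -- Only a push increases a depth, and by one. The truncated difference capped at 1 is the
  -- indicator that `x` lies strictly above `u`; the other factor says that `x` is on the path.
  step-length : ∀ x → length (step u bs pos x) ≤
    length (pos x) + (1 ⊓ (length (pos u) ∸ length (pos x))) * isPrefix (pos x) (toList bs)
  step-length x with x Fin.≟ u
  ... | yes _ = z≤n
  ... | no _ with length (pos x) <? length (pos u) | pos x ≟ₐ take (length (pos x)) (toList bs)
                | pos x ≟ₐ take (length (pos u)) (toList bs)
  ... | yes a<k | yes on | _  rewrite isPrefix-take (pos x) (toList bs) on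
                                    | m≤n⇒m⊓n≡m (m<n⇒0<n∸m a<k) = begin
    length (take (suc (length (pos x))) (toList bs)) ≡⟨ length-take-path (suc (length (pos x))) ⟩
    suc (length (pos x)) ⊓ h                         ≤⟨ m⊓n≤m _ h ⟩
    suc (length (pos x))                             ≡⟨ +-comm 1 (length (pos x)) ⟩
    length (pos x) + 1                               ∎
  ... | yes _ | no _  | yes e = m≤n⇒m≤n+o _ (≤-reflexive (swap-length e))
  ... | yes _ | no _  | no _  = m≤m+n _ _
  ... | no _  | _     | yes e = m≤n⇒m≤n+o _ (≤-reflexive (swap-length e))
  ... | no _  | _     | no _  = m≤m+n _ _

-- Bounds for the binary logarithm.

-- Taking an arbitrary accessibility proof lets the induction follow the halving recursion that
-- defines the logarithm.
2^⌊log2⌋≤ : ∀ n (a : Acc _<_ n) → 1 ≤ n → 2 ^ ⌊log2⌋ n a ≤ n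
2^⌊log2⌋≤ 1 a _ = ≤-refl
2^⌊log2⌋≤ (suc (suc n)) (acc rs) _ = begin
  2 * 2 ^ ⌊log2⌋ (suc ⌊ n /2⌋) _ ≤⟨ *-monoʳ-≤ 2 (2^⌊log2⌋≤ (suc ⌊ n /2⌋) _ (s≤s z≤n)) ⟩
  2 * suc ⌊ n /2⌋                ≡⟨ eq ⌊ n /2⌋ ⟩
  2 + (⌊ n /2⌋ + ⌊ n /2⌋)        ≤⟨ +-monoʳ-≤ (2 + ⌊ n /2⌋) (⌊n/2⌋≤⌈n/2⌉ n) ⟩
  2 + (⌊ n /2⌋ + _)              ≡⟨ cong (2 +_) (⌊n/2⌋+⌈n/2⌉≡n n) ⟩
  2 + n                          ∎
  where
  eq : ∀ m → 2 * suc m ≡ 2 + (m + m)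
  eq = solve-∀

-- Otherwise monotonicity of the logarithm would put `suc ⌊log₂ n ⌋` below `⌊log₂ n ⌋`.
n<2^[1+⌊log₂n⌋] : ∀ n → n < 2 ^ suc ⌊log₂ n ⌋
n<2^[1+⌊log₂n⌋] n = ≰⇒> λ le → 1+n≰n (begin
  suc ⌊log₂ n ⌋              ≡⟨ ⌊log₂[2^n]⌋≡n (suc ⌊log₂ n ⌋) ⟨
  ⌊log₂ 2 ^ suc ⌊log₂ n ⌋ ⌋  ≤⟨ ⌊log₂⌋-mono-≤ le ⟩
  ⌊log₂ n ⌋                  ∎)

-- The potential and its expected change in one step.

excess : ∀ {n} → ℕ → Config n → Fin n → ℕ
excess L pos x = length (pos x) ∸ L

-- If `2 * length W ≤ 2 ^ L`, pushes raise each of the two terms by at most 1 in expectation. The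
-- factor 2 lets one unit of excess lost by an item of `W` offset both.
Ψ : ∀ {n} → ℕ → Fin n → List (Fin n) → Config n → ℕ
Ψ L v W pos = 2 ^ L * excess L pos v + 2 * ∑ W (excess L pos)

module _ {n h} (L : ℕ) (u : Fin n) (pos : Config n) (bounded : Bounded h pos) where

  private
    H = 2 ^ h
    P = 2 ^ L
    e = excess L pos
    -- Indicator that the requested item is deeper than `L`.
    δ = 1 ⊓ e u

    e′ : Fin n → Vec Bool h → ℕ
    e′ x bs = excess L (step u bs pos) x

    instance
      P≢0 : NonZero P
      P≢0 = m^n≢0 2 L

  -- An item above depth `L` gets at most to depth `L`. An item at depth `L` or more is on the path
  -- with probability at most `1 / P`, and is pushed only if `u` is deeper still, which forces `δ`
  -- to be 1. Multiplying by `P * H` clears denominators.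
  ∑-excess-step : ∀ x → P * ∑ (bitVecs h) (e′ x) ≤ P * (H * e x) + δ * H
  ∑-excess-step x with <-≤-connex (length (pos x)) L
  ... | inj₁ a<L = begin
    P * ∑ (bitVecs h) (e′ x)        ≤⟨ *-monoʳ-≤ P (∑-mono (bitVecs h) no-excess) ⟩
    P * ∑ (bitVecs h) (λ _ → 0)     ≡⟨ cong (P *_) (∑-zero (bitVecs h)) ⟩
    P * 0                           ≡⟨ *-zeroʳ P ⟩
    0                               ≤⟨ z≤n ⟩
    P * (H * e x) + δ * H           ∎
    where
    no-excess : ∀ bs → e′ x bs ≤ 0
    no-excess bs = ≤-reflexive (m≤n⇒m∸n≡0 (begin
      length (step u bs pos x)   ≤⟨ step-length u bs pos bounded x ⟩
      length (pos x) + _         ≤⟨ +-monoʳ-≤ (length (pos x)) (*-mono-≤ (m⊓n≤m 1 (length (pos u) ∸ length (pos x))) (isPrefix≤1 (pos x) (toList bs))) ⟩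
      length (pos x) + 1         ≡⟨ +-comm (length (pos x)) 1 ⟩
      suc (length (pos x))       ≤⟨ a<L ⟩
      L                          ∎))
  ... | inj₂ L≤a = begin
    P * ∑ (bitVecs h) (e′ x)
      ≤⟨ *-monoʳ-≤ P (∑-mono (bitVecs h) one-push) ⟩
    P * ∑ (bitVecs h) (λ bs → e x + δ * isPrefix (pos x) (toList bs))
      ≡⟨ cong (P *_) (trans (∑-+ (bitVecs h) _ _) (cong₂ _+_ (trans (∑-const (bitVecs h) (e x)) (cong (_* e x) (length-bitVecs h))) (∑-*ˡ (bitVecs h) δ _))) ⟩
    P * (H * e x + δ * Q)
      ≡⟨ eq P (H * e x) δ Q ⟩
    P * (H * e x) + δ * (P * Q)
      ≤⟨ +-monoʳ-≤ (P * (H * e x)) (*-monoʳ-≤ δ (≤-trans (*-monoˡ-≤ Q (^-monoʳ-≤ 2 L≤a)) (∑-isPrefix h (pos x)))) ⟩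
    P * (H * e x) + δ * H ∎
    where
    Q = ∑ (bitVecs h) (isPrefix (pos x) ∘ toList)
    eq : ∀ p a d q → p * (a + d * q) ≡ p * a + d * (p * q)
    eq = solve-∀
    one-push : ∀ bs → e′ x bs ≤ e x + δ * isPrefix (pos x) (toList bs)
    one-push bs = begin
      length (step u bs pos x) ∸ L
        ≤⟨ ∸-monoˡ-≤ L (step-length u bs pos bounded x) ⟩
      length (pos x) + (1 ⊓ (length (pos u) ∸ length (pos x))) * b ∸ L
        ≤⟨ ∸-monoˡ-≤ L (+-monoʳ-≤ (length (pos x)) (*-monoˡ-≤ b (⊓-monoʳ-≤ 1 (∸-monoʳ-≤ (length (pos u)) L≤a)))) ⟩
      length (pos x) + δ * b ∸ L
        ≡⟨ +-∸-comm (δ * b) L≤a ⟩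
      e x + δ * b ∎
      where b = isPrefix (pos x) (toList bs)

  excess-requested : ∀ bs → e′ u bs ≡ 0
  excess-requested bs = trans (cong (λ a → length a ∸ L) (step-requested u bs pos bounded)) (0∸n≡0 L)

  ∑-excess-steps : ∀ W → P * ∑ (bitVecs h) (λ bs → ∑ W (λ w → e′ w bs))
    ≤ P * (H * ∑ W e) + length W * (δ * H)
  ∑-excess-steps [] = ≤-trans (≤-reflexive (trans
    (cong (P *_) (∑-zero (bitVecs h))) (*-zeroʳ P))) z≤n
  ∑-excess-steps (w ∷ W) = begin
    P * ∑ (bitVecs h) (λ bs → e′ w bs + ∑ W (λ w → e′ w bs))
      ≡⟨ trans (cong (P *_) (∑-+ (bitVecs h) _ _)) (*-distribˡ-+ P _ _) ⟩
    P * ∑ (bitVecs h) (e′ w) + P * ∑ (bitVecs h) (λ bs → ∑ W (λ w → e′ w bs))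
      ≤⟨ +-mono-≤ (∑-excess-step w) (∑-excess-steps W) ⟩
    P * (H * e w) + δ * H + (P * (H * ∑ W e) + length W * (δ * H))
      ≡⟨ eq P H (e w) (∑ W e) (δ * H) (length W) ⟩
    P * (H * (e w + ∑ W e)) + (δ * H + length W * (δ * H)) ∎
    where
    eq : ∀ p h a b d l → p * (h * a) + d + (p * (h * b) + l * d) ≡ p * (h * (a + b)) + (d + l * d)
    eq = solve-∀

  -- The requested item itself loses all of its excess, which is at least δ.
  ∑-excess-steps-∈ : ∀ {W} → u ∈ W →
    P * ∑ (bitVecs h) (λ bs → ∑ W (λ w → e′ w bs)) + P * (H * δ)
      ≤ P * (H * ∑ W e) + length W * (δ * H)
  ∑-excess-steps-∈ {w ∷ W} (here refl) = begin
    P * ∑ (bitVecs h) (λ bs → e′ u bs + ∑ W (λ w → e′ w bs)) + P * (H * δ)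
      ≡⟨ cong (λ z → P * z + P * (H * δ)) (trans (∑-+ (bitVecs h) _ _) (cong (_+ ∑ (bitVecs h) (λ bs → ∑ W (λ w → e′ w bs))) (trans (∑-cong (bitVecs h) excess-requested) (∑-zero (bitVecs h))))) ⟩
    P * ∑ (bitVecs h) (λ bs → ∑ W (λ w → e′ w bs)) + P * (H * δ)
      ≤⟨ +-mono-≤ (∑-excess-steps W) (*-monoʳ-≤ P (*-monoʳ-≤ H (m⊓n≤n 1 (e u)))) ⟩
    P * (H * ∑ W e) + length W * (δ * H) + P * (H * e u)
      ≡⟨ eq P H (e u) (∑ W e) (length W * (δ * H)) ⟩
    P * (H * (e u + ∑ W e)) + length W * (δ * H)
      ≤⟨ +-monoʳ-≤ (P * (H * (e u + ∑ W e))) (m≤n+m _ (δ * H)) ⟩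
    P * (H * (e u + ∑ W e)) + (δ * H + length W * (δ * H)) ∎
    where
    eq : ∀ p h a b d → p * (h * b) + d + p * (h * a) ≡ p * (h * (a + b)) + d
    eq = solve-∀
  ∑-excess-steps-∈ {w ∷ W} (there u∈W) = begin
    P * ∑ (bitVecs h) (λ bs → e′ w bs + ∑ W (λ w → e′ w bs)) + P * (H * δ)
      ≡⟨ cong (_+ P * (H * δ)) (trans (cong (P *_) (∑-+ (bitVecs h) _ _)) (*-distribˡ-+ P _ _)) ⟩
    P * ∑ (bitVecs h) (e′ w) + P * ∑ (bitVecs h) (λ bs → ∑ W (λ w → e′ w bs)) + P * (H * δ)
      ≡⟨ +-assoc (P * ∑ (bitVecs h) (e′ w)) _ _ ⟩
    P * ∑ (bitVecs h) (e′ w) + (P * ∑ (bitVecs h) (λ bs → ∑ W (λ w → e′ w bs)) + P * (H * δ))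
      ≤⟨ +-mono-≤ (∑-excess-step w) (∑-excess-steps-∈ u∈W) ⟩
    P * (H * e w) + δ * H + (P * (H * ∑ W e) + length W * (δ * H))
      ≡⟨ eq P H (e w) (∑ W e) (δ * H) (length W) ⟩
    P * (H * (e w + ∑ W e)) + (δ * H + length W * (δ * H)) ∎
    where
    eq : ∀ p h a b d l → p * (h * a) + d + (p * (h * b) + l * d) ≡ p * (h * (a + b)) + (d + l * d)
    eq = solve-∀

  module _ (v : Fin n) (W : List (Fin n)) (small : 2 * length W ≤ P) where

    private
      X = ∑ (bitVecs h) (e′ v)
      Y = ∑ (bitVecs h) (λ bs → ∑ W (λ w → e′ w bs))

      ∑-Ψ : ∑ (bitVecs h) (λ bs → Ψ L v W (step u bs pos)) ≡ P * X + 2 * Y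
      ∑-Ψ = trans (∑-+ (bitVecs h) _ _) (cong₂ _+_ (∑-*ˡ (bitVecs h) P _) (∑-*ˡ (bitVecs h) 2 _))

      eq : ∀ p h a b d l → p * (p * (h * a) + d) + 2 * (p * (h * b) + l * d)
        ≡ p * (h * (p * a + 2 * b)) + (p * d + 2 * l * d)
      eq = solve-∀

    -- The terms for `v` and for `W` gain at most `δ` each in expectation, while `u` pays back
    -- `2 * δ`. This loss is added to both sides and cancelled, which avoids subtraction.
    Ψ-step-seen : u ∈ W → ∑ (bitVecs h) (λ bs → Ψ L v W (step u bs pos)) ≤ H * Ψ L v W pos
    Ψ-step-seen u∈W = *-cancelˡ-≤ P (+-cancelʳ-≤ (P * (δ * H) + P * (δ * H)) _ _ (begin
      P * ∑ (bitVecs h) (λ bs → Ψ L v W (step u bs pos)) + (P * (δ * H) + P * (δ * H))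
        ≡⟨ cong (λ z → P * z + (P * (δ * H) + P * (δ * H))) ∑-Ψ ⟩
      P * (P * X + 2 * Y) + (P * (δ * H) + P * (δ * H))
        ≡⟨ eq₁ P X Y δ H ⟩
      P * (P * X) + 2 * (P * Y + P * (H * δ))
        ≤⟨ +-mono-≤ (*-monoʳ-≤ P (∑-excess-step v)) (*-monoʳ-≤ 2 (∑-excess-steps-∈ u∈W)) ⟩
      P * (P * (H * e v) + δ * H) + 2 * (P * (H * ∑ W e) + length W * (δ * H))
        ≡⟨ eq P H (e v) (∑ W e) (δ * H) (length W) ⟩
      P * (H * Ψ L v W pos) + (P * (δ * H) + 2 * length W * (δ * H))
        ≤⟨ +-monoʳ-≤ (P * (H * Ψ L v W pos)) (+-monoʳ-≤ (P * (δ * H)) (*-monoˡ-≤ (δ * H) small)) ⟩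
      P * (H * Ψ L v W pos) + (P * (δ * H) + P * (δ * H)) ∎))
      where
      eq₁ : ∀ p x y d h → p * (p * x + 2 * y) + (p * (d * h) + p * (d * h)) ≡ p * (p * x) + 2 * (p * y + p * (h * d))
      eq₁ = solve-∀

    -- After being served, `u` is at the root and has no excess, so it joins `W` for free; only the
    -- two gains of at most `δ ≤ 1` remain.
    Ψ-step-fresh : ∑ (bitVecs h) (λ bs → Ψ L v (u ∷ W) (step u bs pos)) ≤ H * (Ψ L v W pos + 2)
    Ψ-step-fresh = *-cancelˡ-≤ P (begin
      P * ∑ (bitVecs h) (λ bs → Ψ L v (u ∷ W) (step u bs pos))
        ≡⟨ cong (P *_) (trans (∑-cong (bitVecs h) drop-requested) ∑-Ψ) ⟩
      P * (P * X + 2 * Y)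
        ≡⟨ eq₁ P X Y ⟩
      P * (P * X) + 2 * (P * Y)
        ≤⟨ +-mono-≤ (*-monoʳ-≤ P (∑-excess-step v)) (*-monoʳ-≤ 2 (∑-excess-steps W)) ⟩
      P * (P * (H * e v) + δ * H) + 2 * (P * (H * ∑ W e) + length W * (δ * H))
        ≡⟨ eq P H (e v) (∑ W e) (δ * H) (length W) ⟩
      P * (H * Ψ L v W pos) + (P * (δ * H) + 2 * length W * (δ * H))
        ≤⟨ +-monoʳ-≤ (P * (H * Ψ L v W pos)) (+-monoʳ-≤ (P * (δ * H)) (*-monoˡ-≤ (δ * H) small)) ⟩
      P * (H * Ψ L v W pos) + (P * (δ * H) + P * (δ * H))
        ≤⟨ +-monoʳ-≤ (P * (H * Ψ L v W pos)) (+-mono-≤ δ≤ δ≤) ⟩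
      P * (H * Ψ L v W pos) + (P * (1 * H) + P * (1 * H))
        ≡⟨ eq₂ P H (Ψ L v W pos) ⟩
      P * (H * (Ψ L v W pos + 2)) ∎)
      where
      δ≤ : P * (δ * H) ≤ P * (1 * H)
      δ≤ = *-monoʳ-≤ P (*-monoˡ-≤ H (m⊓n≤m 1 (e u)))
      drop-requested : ∀ bs → Ψ L v (u ∷ W) (step u bs pos) ≡ Ψ L v W (step u bs pos)
      drop-requested bs = cong (λ z → P * e′ v bs + 2 * (z + ∑ W (λ w → e′ w bs))) (excess-requested bs)
      eq₁ : ∀ p x y → p * (p * x + 2 * y) ≡ p * (p * x) + 2 * (p * y)
      eq₁ = solve-∀
      eq₂ : ∀ p h a → p * (h * a) + (p * (1 * h) + p * (1 * h)) ≡ p * (h * (a + 2))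
      eq₂ = solve-∀

-- Iterating the one-step bounds along a run.

module _ {n} (h L : ℕ) (σ : ℕ → Fin n) (v : Fin n) where

  private
    N : ℕ → ℕ
    N t = (2 ^ h) ^ t

    ∑-run : ∀ t → ℕ → Config n → ℕ
    ∑-run t i pos = ∑ (choices h t) (λ bss → 2 ^ L * excess L (runFrom σ i bss pos) v)

  ∑-run-∷ : ∀ t i pos →
    ∑-run (suc t) i pos ≡ ∑ (bitVecs h) (λ bs → ∑-run t (suc i) (step (σ i) bs pos))
  ∑-run-∷ t i pos = ∑-vecsOver (bitVecs h) t _

  -- W holds items already requested; any request to an item outside W removes
  -- it from R, so 2 * length R pays for all future growth of Ψ.
  ∑-run-after : ∀ s i pos W R → Bounded h pos → 2 * (length W + length R) ≤ 2 ^ L →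
    (∀ j → i ≤ j → j < i + s → σ j ∈ W ⊎ σ j ∈ R) →
    ∑-run s i pos ≤ N s * (Ψ L v W pos + 2 * length R)
  ∑-run-after zero i pos W R bounded small cover = begin
    2 ^ L * excess L pos v + 0       ≡⟨ +-identityʳ _ ⟩
    2 ^ L * excess L pos v           ≤⟨ m≤m+n _ _ ⟩
    Ψ L v W pos                      ≤⟨ m≤m+n _ _ ⟩
    Ψ L v W pos + 2 * length R       ≡⟨ *-identityˡ _ ⟨
    1 * (Ψ L v W pos + 2 * length R) ∎
  ∑-run-after (suc s) i pos W R bounded small cover = split (u ∈? W)
    where
    u = σ i
    open import Data.List.Membership.DecPropositional (Fin._≟_ {n}) using (_∈?_)

    later : ∀ j → suc i ≤ j → j < suc i + s → σ j ∈ W ⊎ σ j ∈ R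
    later j i<j j< = cover j (<⇒≤ i<j) (subst (j <_) (sym (+-suc i s)) j<)

    smallW : 2 * length W ≤ 2 ^ L
    smallW = ≤-trans (*-monoʳ-≤ 2 (m≤m+n (length W) (length R))) small

    -- The induction step common to both cases: the inductive bound is applied after each outcome of
    -- the first step and then averaged. It remains to check that potential plus budget does not
    -- grow in expectation.
    average : ∀ W′ R′ → 2 * (length W′ + length R′) ≤ 2 ^ L →
      (∀ j → suc i ≤ j → j < suc i + s → σ j ∈ W′ ⊎ σ j ∈ R′) →
      ∑ (bitVecs h) (λ bs → Ψ L v W′ (step u bs pos)) + 2 ^ h * (2 * length R′)
        ≤ 2 ^ h * (Ψ L v W pos + 2 * length R) →
      ∑-run (suc s) i pos ≤ N (suc s) * (Ψ L v W pos + 2 * length R)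
    average W′ R′ small′ cover′ le = begin
      ∑-run (suc s) i pos
        ≡⟨ ∑-run-∷ s i pos ⟩
      ∑ (bitVecs h) (λ bs → ∑-run s (suc i) (step u bs pos))
        ≤⟨ ∑-mono (bitVecs h) (λ bs → ∑-run-after s (suc i) (step u bs pos) W′ R′ (step-bounded u bs pos bounded) small′ cover′) ⟩
      ∑ (bitVecs h) (λ bs → N s * (Ψ L v W′ (step u bs pos) + 2 * length R′))
        ≡⟨ trans (∑-*ˡ (bitVecs h) (N s) _) (cong (N s *_) (trans (∑-+ (bitVecs h) _ _)
             (cong (S +_) (trans (∑-const (bitVecs h) _) (cong (_* (2 * length R′)) (length-bitVecs h)))))) ⟩
      N s * (S + 2 ^ h * (2 * length R′))
        ≤⟨ *-monoʳ-≤ (N s) le ⟩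
      N s * (2 ^ h * (Ψ L v W pos + 2 * length R))
        ≡⟨ eq (N s) (2 ^ h) _ ⟩
      N (suc s) * (Ψ L v W pos + 2 * length R) ∎
      where
      S = ∑ (bitVecs h) (λ bs → Ψ L v W′ (step u bs pos))
      eq : ∀ a b c → a * (b * c) ≡ b * a * c
      eq = solve-∀

    split : _ → ∑-run (suc s) i pos ≤ N (suc s) * (Ψ L v W pos + 2 * length R)
    split (yes u∈W) = average W R small later (begin
      ∑ (bitVecs h) (λ bs → Ψ L v W (step u bs pos)) + 2 ^ h * (2 * length R)
        ≤⟨ +-monoˡ-≤ _ (Ψ-step-seen L u pos bounded v W smallW u∈W) ⟩
      2 ^ h * Ψ L v W pos + 2 ^ h * (2 * length R)
        ≡⟨ *-distribˡ-+ (2 ^ h) _ _ ⟨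
      2 ^ h * (Ψ L v W pos + 2 * length R) ∎)
    -- Moving `u` from `R` to `W` keeps the total size within its bound and releases at least 2
    -- units of budget, which cover the growth of the potential.
    split (no u∉W) = average (u ∷ W) R′
      (≤-trans (*-monoʳ-≤ 2 (≤-trans (≤-reflexive (sym (+-suc (length W) (length R′)))) (+-monoʳ-≤ (length W) shorter))) small)
      cover′ (begin
      ∑ (bitVecs h) (λ bs → Ψ L v (u ∷ W) (step u bs pos)) + 2 ^ h * (2 * length R′)
        ≤⟨ +-monoˡ-≤ _ (Ψ-step-fresh L u pos bounded v W smallW) ⟩
      2 ^ h * (Ψ L v W pos + 2) + 2 ^ h * (2 * length R′)
        ≡⟨ eq (2 ^ h) (Ψ L v W pos) (length R′) ⟩
      2 ^ h * (Ψ L v W pos + 2 * suc (length R′))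
        ≤⟨ *-monoʳ-≤ (2 ^ h) (+-monoʳ-≤ (Ψ L v W pos) (*-monoʳ-≤ 2 shorter)) ⟩
      2 ^ h * (Ψ L v W pos + 2 * length R) ∎)
      where
      eq : ∀ a b c → a * (b + 2) + a * (2 * c) ≡ a * (b + 2 * suc c)
      eq = solve-∀
      R′ = filter (λ x → ¬? (x Fin.≟ u)) R
      u∈R : u ∈ R
      -- The covering hypothesis is used at the current time `i`, where `W` is already excluded.
      u∈R with cover i ≤-refl (m<m+n i z<s)
      ... | inj₁ u∈W = contradiction u∈W u∉W
      ... | inj₂ u∈R = u∈R
      shorter : length R′ < length R
      shorter = filter-notAll (λ x → ¬? (x Fin.≟ u)) R (Any.map (λ u≡x x≢u → x≢u (sym u≡x)) u∈R)
      cover′ : ∀ j → suc i ≤ j → j < suc i + s → σ j ∈ u ∷ W ⊎ σ j ∈ R′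
      cover′ j i<j j< with σ j Fin.≟ u | later j i<j j<
      ... | yes σj≡u | _       = inj₁ (here σj≡u)
      ... | no _     | inj₁ ∈W = inj₁ (there ∈W)
      ... | no σj≢u  | inj₂ ∈R = inj₂ (∈-filter⁺ (λ x → ¬? (x Fin.≟ u)) ∈R σj≢u)

  ∑-run-uniform : ∀ t i pos {c} → (∀ bs → ∑-run t (suc i) (step (σ i) bs pos) ≤ N t * c) →
    ∑-run (suc t) i pos ≤ N (suc t) * c
  ∑-run-uniform t i pos {c} le = begin
    ∑-run (suc t) i pos
      ≡⟨ ∑-run-∷ t i pos ⟩
    ∑ (bitVecs h) (λ bs → ∑-run t (suc i) (step (σ i) bs pos))
      ≤⟨ ∑-mono (bitVecs h) le ⟩
    ∑ (bitVecs h) (λ _ → N t * c)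
      ≡⟨ trans (∑-const (bitVecs h) _) (cong (_* (N t * c)) (length-bitVecs h)) ⟩
    2 ^ h * (N t * c)
      ≡⟨ *-assoc (2 ^ h) (N t) c ⟨
    N (suc t) * c ∎

  -- The `m` steps before the request of `v` may lead to any bounded configuration: the bound after
  -- that request does not depend on it, since `v` is then at the root.
  ∑-run-from : ∀ m s i pos R → Bounded h pos → 2 * length R ≤ 2 ^ L → σ (i + m) ≡ v →
    (∀ j → i + m < j → j < suc (i + m) + s → σ j ∈ R) →
    ∑-run (m + suc s) i pos ≤ N (m + suc s) * (2 * length R)
  ∑-run-from zero s i pos R bounded small hit cover rewrite +-identityʳ i =
    ∑-run-uniform s i pos λ bs → begin
      ∑-run s (suc i) (step (σ i) bs pos)
        -- Right after the request of `v` no item counts as seen, so `W` is empty and all of `R` is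
        -- budget.
        ≤⟨ ∑-run-after s (suc i) (step (σ i) bs pos) [] R (step-bounded (σ i) bs pos bounded) small
             (λ j i<j j< → inj₂ (cover j i<j j<)) ⟩
      N s * (Ψ L v [] (step (σ i) bs pos) + 2 * length R)
        ≡⟨ cong (λ u → N s * (Ψ L u [] (step (σ i) bs pos) + 2 * length R)) (sym hit) ⟩
      N s * (Ψ L (σ i) [] (step (σ i) bs pos) + 2 * length R)
        ≡⟨ cong (λ z → N s * (z + 2 * length R)) (Ψ-requested bs) ⟩
      N s * (2 * length R) ∎
    where
    Ψ-requested : ∀ bs → Ψ L (σ i) [] (step (σ i) bs pos) ≡ 0
    Ψ-requested bs = trans (+-identityʳ _) (trans
      (cong (2 ^ L *_) (excess-requested L (σ i) pos bounded bs)) (*-zeroʳ (2 ^ L)))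
  ∑-run-from (suc m) s i pos R bounded small hit cover rewrite +-suc i m =
    ∑-run-uniform (m + suc s) i pos λ bs →
      ∑-run-from m s (suc i) (step (σ i) bs pos) R (step-bounded (σ i) bs pos bounded) small hit cover

-- From excess to depth.

-- A depth is at most `L` plus the excess, whose expectation is at most `2 * r / 2 ^ L < 1`.
totalDepth-bound : ∀ {n} h L (σ : ℕ → Fin n) pos₀ t v r → Bounded h pos₀ → HasRank σ t v r → 2 * r < 2 ^ L →
  totalDepth h σ pos₀ t v < (L + 1) * 2 ^ (h * t)
totalDepth-bound h L σ pos₀ t v r bounded (τ , τ<t , hit , _ , r≡) small =
  *-cancelˡ-< P _ _ (begin-strict
    P * totalDepth h σ pos₀ t v
      ≤⟨ *-monoʳ-≤ P (∑-mono (choices h t) (λ bss → m≤n+m∸n (length (run σ bss pos₀ v)) L)) ⟩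
    P * ∑ (choices h t) (λ bss → L + e bss)
      ≡⟨ cong (P *_) (trans (∑-+ (choices h t) _ _) (cong (_+ ∑ (choices h t) e) (trans (∑-const (choices h t) L) (cong (_* L) (length-choices h t))))) ⟩
    P * (M * L + ∑ (choices h t) e)
      ≡⟨ *-distribˡ-+ P (M * L) _ ⟩
    P * (M * L) + P * ∑ (choices h t) e
      ≡⟨ cong (P * (M * L) +_) (∑-*ˡ (choices h t) P e) ⟨
    P * (M * L) + ∑ (choices h t) (λ bss → P * e bss)
      ≤⟨ +-monoʳ-≤ (P * (M * L)) bound ⟩
    P * (M * L) + M * (2 * r)
      <⟨ +-monoʳ-< (P * (M * L)) (*-monoʳ-< M small) ⟩
    P * (M * L) + M * P
      ≡⟨ eq P M L ⟩
    P * ((L + 1) * M) ∎)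
  where
  P = 2 ^ L
  M = 2 ^ (h * t)
  R = deduplicate Fin._≟_ (window σ τ t)
  e : Vec (Vec Bool h) t → ℕ
  e bss = excess L (run σ bss pos₀) v
  instance
    M≢0 : NonZero M
    M≢0 = m^n≢0 2 (h * t)
  eq : ∀ p m l → p * (m * l) + m * p ≡ p * ((l + 1) * m)
  eq = solve-∀
  -- The run splits into `τ` earlier steps, the step serving `v`, and `t ∸ suc τ` later ones.
  t≡ : τ + suc (t ∸ suc τ) ≡ t
  t≡ = trans (+-suc τ _) (m+[n∸m]≡n τ<t)
  requested : ∀ j → τ < j → j < suc τ + (t ∸ suc τ) → σ j ∈ R
  requested j τ<j j< = ∈-deduplicate⁺ Fin._≟_ (subst (λ k → σ k ∈ window σ τ t) (m+[n∸m]≡n (<⇒≤ τ<j))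
    (∈-map⁺ (λ i → σ (τ + i)) (∈-upTo⁺ (∸-monoˡ-< (subst (j <_) (m+[n∸m]≡n τ<t) j<) (<⇒≤ τ<j)))))
  bound : ∑ (choices h t) (λ bss → P * e bss) ≤ M * (2 * r)
  bound = begin
    ∑ (choices h t) (λ bss → P * e bss)
      ≤⟨ subst (λ t → ∑ (choices h t) (λ bss → P * excess L (run σ bss pos₀) v) ≤ (2 ^ h) ^ t * (2 * length R)) t≡
           (∑-run-from h L σ v τ (t ∸ suc τ) 0 pos₀ R bounded
             (≤-trans (≤-reflexive (cong (2 *_) (sym r≡))) (<⇒≤ small)) hit requested) ⟩
    (2 ^ h) ^ t * (2 * length R)
      ≡⟨ cong₂ (λ m l → m * (2 * l)) (^-*-assoc 2 h t) (sym r≡) ⟩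
    M * (2 * r) ∎

-- With `M = 2 ^ (h * t)` outcomes, a mean depth below log₂ r + 3 means a total below `M` times that
-- real number; exponentiating with base 2 keeps the inequality within the naturals.
theorem7 : (h : ℕ) (pos₀ : Config (2 ^ h ∸ 1))
    → Injective _≡_ _≡_ pos₀
    → (∀ x → length (pos₀ x) < h)
    → (∀ (a : Address) → length a < h → Σ (Fin (2 ^ h ∸ 1)) (λ x → pos₀ x ≡ a))
    → (σ : ℕ → Fin (2 ^ h ∸ 1)) (t : ℕ) (v : Fin (2 ^ h ∸ 1)) (r : ℕ)
    → 1 ≤ r
    → HasRank σ t v r
    → (2 ^ totalDepth h σ pos₀ t v < (8 * r) ^ (2 ^ (h * t)))
    × (totalDepth h σ pos₀ t v < (⌊log₂ r ⌋ + 4) * 2 ^ (h * t))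
theorem7 h pos₀ _ depth<h _ σ t v r 1≤r rank =
  (begin-strict
    2 ^ D                    <⟨ ^-monoʳ-< 2 (s≤s (s≤s z≤n)) depth ⟩
    2 ^ ((ℓ + 3) * M)        ≡⟨ ^-*-assoc 2 (ℓ + 3) M ⟨
    (2 ^ (ℓ + 3)) ^ M        ≤⟨ ^-monoˡ-≤ M 2^[ℓ+3]≤8r ⟩
    (8 * r) ^ M              ∎)
  , <-≤-trans depth (*-monoˡ-≤ M (+-monoʳ-≤ ℓ (n≤1+n 3)))
  where
  ℓ = ⌊log₂ r ⌋
  D = totalDepth h σ pos₀ t v
  M = 2 ^ (h * t)
  2r<2^[ℓ+2] : 2 * r < 2 ^ (2 + ℓ)
  2r<2^[ℓ+2] = *-monoʳ-< 2 (n<2^[1+⌊log₂n⌋] r)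
  depth : D < (ℓ + 3) * M
  depth = subst (λ z → D < z * M) (trans (+-comm (2 + ℓ) 1) (+-comm 3 ℓ))
    (totalDepth-bound h (2 + ℓ) σ pos₀ t v r (<⇒≤ ∘ depth<h) rank 2r<2^[ℓ+2])
  -- Passing from the floor to the real logarithm costs nothing, because `2 ^ ℓ ≤ r`.
  2^[ℓ+3]≤8r : 2 ^ (ℓ + 3) ≤ 8 * r
  2^[ℓ+3]≤8r = begin
    2 ^ (ℓ + 3)   ≡⟨ ^-distribˡ-+-* 2 ℓ 3 ⟩
    2 ^ ℓ * 8     ≤⟨ *-monoˡ-≤ 8 (2^⌊log2⌋≤ r _ 1≤r) ⟩
    r * 8         ≡⟨ *-comm r 8 ⟩
    8 * r         ∎
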